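{- Let $G=G(V,E)$ be a finite simple graph and let $n\ge |V|$ be an integer. If $\mathrm{bal}(n,G)$ exists, then $\mathrm{bal}(n,G)=\mathrm{lbal}(n,G)<\frac{1}{2}\binom{n}{2}$.
   Context: A 2-coloring of the edges of $K_n$ is a partition $E(K_n)=R\sqcup B$ (red edges and blue edges). A 2-list coloring of the edges of $K_n$ is a function $L:E(K_n)\to\{\{r\},\{b\},\{r,b\}\}$; it induces color classes $R=\{e: r\in L(e)\}$ and $B=\{e: b\in L(e)\}$, so $R\cup B=E(K_n)$ but $R$ and $B$ may intersect. Given a 2-coloring or a 2-list coloring with color classes $R,B$, a balanced copy of a graph $G=G(V,E)$ is a (not necessarily induced) copy of $G$ in $K_n$ whose edge set has a partition $E_1\sqcup E_2$ with $E_1\subseteq R$, $E_2\subseteq B$ and $\bigl||E_1|-|E_2|\bigr|\le 1$. Balancing number: $\mathrm{bal}(n,G)$ is the smallest integer $k$ such that every 2-coloring $R\sqcup B$ of the edges of $K_n$ with $|R|,|B|>k$ contains a balanced copy of $G$, where the condition $|R|,|B|>k$ is required to be satisfiable by some 2-coloring, i.e. $2(k+1)\le\binom{n}{2}$; $\mathrm{bal}(n,G)$ exists if there is such a $k$. List balancing number: for $n\ge |V|$, $\mathrm{lbal}(n,G)$ is the smallest integer $k$ such that every 2-list coloring of the edges of $K_n$ with color classes satisfying $|R|,|B|>k$ contains a balanced copy of $G$. -}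

module Defs where

open import Data.Bool using (Bool; true; false; T)
open import Data.Fin using (Fin; zero; suc; _<_)
open import Data.Fin.Properties using (<-cmp; <⇒≢)
open import Data.List using (List; []; map; _++_; length; filterᵇ; allFin)
open import Data.Nat as ℕ using (ℕ; zero; suc; _*_; _≤_; s<s; z<s; ∣_-_∣)
open import Data.Nat.Combinatorics using (_C_)
open import Data.Product using (_×_; ∃; ∃-syntax)
open import Function using (_∘_; _↣_; Injection)
open import Level using (0ℓ)
open import Relation.Binary.Definitions using (tri<; tri≈; tri>)
open import Relation.Binary.PropositionalEquality using (_≡_; _≢_)
open import Relation.Nullary using (contradiction)
open import Relation.Unary using (Pred; U; _≐_; _∪_; _⊥_; _⊆_)

-- An edge of K_n is a two-element subset of Fin n, encoded as the pair of its
-- elements in increasing order.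

record Edge (n : ℕ) : Set where
  constructor edge
  field
    u v : Fin n
    u<v : u < v

open Edge public

unordered : ∀ {n} (i j : Fin n) → i ≢ j → Edge n
unordered i j i≢j with <-cmp i j
... | tri< i<j _ _ = edge i j i<j
... | tri≈ _ i≡j _ = contradiction i≡j i≢j
... | tri> _ _ j<i = edge j i j<i

sucEdge : ∀ {n} → Edge n → Edge (suc n)
sucEdge (edge i j i<j) = edge (suc i) (suc j) (s<s i<j)

-- Every edge of K_n, each listed exactly once.

edges : ∀ n → List (Edge n)
edges zero    = []
edges (suc n) = map (λ j → edge zero (suc j) z<s) (allFin n) ++ map sucEdge (edges n)

EdgeSet : ℕ → Set
EdgeSet n = Edge n → Bool

⟦_⟧ : ∀ {n} → EdgeSet n → Pred (Edge n) 0ℓ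
⟦ S ⟧ e = T (S e)

∣_∣ : ∀ {n} → EdgeSet n → ℕ
∣_∣ {n} S = length (filterᵇ S (edges n))

infix 4 _≐_⊔_

_≐_⊔_ : ∀ {n} → Pred (Edge n) 0ℓ → EdgeSet n → EdgeSet n → Set
P ≐ S₁ ⊔ S₂ = (P ≐ ⟦ S₁ ⟧ ∪ ⟦ S₂ ⟧) × (⟦ S₁ ⟧ ⊥ ⟦ S₂ ⟧)

-- Finite simple graphs, with vertex set Fin order.

record Graph : Set where
  field
    order : ℕ
    E     : EdgeSet order

open Graph public

mapEdge : ∀ {m n} → Fin m ↣ Fin n → Edge m → Edge n
mapEdge φ (edge i j i<j) =
  unordered (to i) (to j) (<⇒≢ i<j ∘ injective)
  where open Injection φ

-- The edge set of the copy of G in K_n with vertices placed by φ.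

copyEdges : ∀ {n} (G : Graph) → Fin (order G) ↣ Fin n → Pred (Edge n) 0ℓ
copyEdges G φ e = ∃[ e′ ] (⟦ E G ⟧ e′ × mapEdge φ e′ ≡ e)

BalancedCopy : ∀ {n} → Graph → (R B : EdgeSet n) → Set
BalancedCopy {n} G R B =
  ∃[ φ ] ∃[ E₁ ] ∃[ E₂ ]
    ( (copyEdges {n} G φ ≐ E₁ ⊔ E₂)
    × (⟦ E₁ ⟧ ⊆ ⟦ R ⟧)
    × (⟦ E₂ ⟧ ⊆ ⟦ B ⟧)
    × (∣ ∣ E₁ ∣ - ∣ E₂ ∣ ∣ ≤ 1))

-- The list colors {r}, {b} and {r,b}.

data ListColor : Set where
  ⟨r⟩ ⟨b⟩ ⟨r,b⟩ : ListColor

r∈ b∈ : ListColor → Bool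
r∈ ⟨r⟩   = true
r∈ ⟨b⟩   = false
r∈ ⟨r,b⟩ = true
b∈ ⟨r⟩   = false
b∈ ⟨b⟩   = true
b∈ ⟨r,b⟩ = true

BalCondition : ℕ → Graph → ℕ → Set
BalCondition n G k =
  (2 * suc k ≤ n C 2) ×
  ((R B : EdgeSet n) → U ≐ R ⊔ B →
   k ℕ.< ∣ R ∣ → k ℕ.< ∣ B ∣ → BalancedCopy G R B)

LbalCondition : ℕ → Graph → ℕ → Set
LbalCondition n G k =
  (L : Edge n → ListColor) →
  k ℕ.< ∣ r∈ ∘ L ∣ → k ℕ.< ∣ b∈ ∘ L ∣ → BalancedCopy G (r∈ ∘ L) (b∈ ∘ L)

IsLeast : (ℕ → Set) → ℕ → Set
IsLeast P k = P k × (∀ j → P j → k ≤ j)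

-- k ranges over ℕ: if G has at most one edge, every coloring contains a balanced
-- copy, so all negative integers would qualify and ℤ would give no smallest one.
-- If G has two or more edges, the monochromatic colorings exclude negative k.

BalExists : ℕ → Graph → Set
BalExists n G = ∃[ k ] BalCondition n G k

IsBal : ℕ → Graph → ℕ → Set
IsBal n G = IsLeast (BalCondition n G)

IsLbal : ℕ → Graph → ℕ → Set
IsLbal n G = IsLeast (LbalCondition n G)

{-# OPTIONS --safe #-}

-- A 2-coloring is a 2-list coloring, so lbal ≥ bal. Conversely, let R, B be the
-- color classes of a 2-list coloring with |R|, |B| > k, where 2(k+1) ≤ C(n,2).
-- If the complement of B has more than k edges, it forms with B a 2-coloring with
-- both classes larger than k. Otherwise some S with ∁B ⊆ S ⊆ R has exactly k+1
-- edges, and S, ∁S is such a 2-coloring. A balanced copy for the 2-coloring is one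
-- for the 2-list coloring. The same bound on k gives bal < C(n,2)/2. The least k
-- exists constructively because everything in sight is finite, hence decidable.

module Submission where

open import Defs
open import Data.Bool using (Bool; true; false; not; _∧_; if_then_else_; T; T?)
open import Data.Bool.Properties using (T-∧; not-involutive)
open import Data.Fin using (Fin; zero; suc)
import Data.Fin.Properties as Fin
open import Data.List using (List; []; _∷_; length; lookup; filterᵇ; map; allFin)
open import Data.List.Membership.Propositional using (_∈_; find; lose)
open import Data.List.Membership.Propositional.Properties
  using (∈-++⁺ˡ; ∈-++⁺ʳ; ∈-map⁺; ∈-map⁻; ∈-allFin)
open import Data.List.Properties
  using (length-++; length-map; length-tabulate; filter-≐)
open import Data.List.Relation.Unary.All using (All; []; _∷_)
open import Data.List.Relation.Unary.AllPairs using ([]; _∷_)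
open import Data.List.Relation.Unary.Any using (any?; index)
open import Data.List.Relation.Unary.Any.Properties using (lookup-index)
open import Data.List.Relation.Unary.Unique.Propositional using (Unique)
import Data.List.Relation.Unary.Unique.Propositional.Properties as Unique
open import Data.Nat using (ℕ; zero; suc; _+_; _*_; _≤_; _<_; _≤?_; _<?_; z≤n; s≤s; ∣_-_∣)
open import Data.Nat.Combinatorics using (_C_; nC1≡n; nCk+nC[k+1]≡[n+1]C[k+1])
open import Data.Nat.Induction using (<-rec)
open import Data.Nat.Properties
open import Data.Product using (_×_; _,_; proj₁; proj₂; ∃; ∃-syntax; Σ-syntax)
open import Data.Sum using (inj₁; inj₂; [_,_]′)
open import Data.Unit using (tt)
open import Data.Vec.Functional using (head; tail) renaming (_∷_ to _∷ᶠ_)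
open import Function using (_∘_; id; _↣_; mk↣; Injection; Equivalence)
open import Relation.Binary.Definitions using (tri<; tri≈; tri>; DecidableEquality; _Respects_)
open import Relation.Binary.PropositionalEquality hiding (resp)
open import Relation.Nullary using (Dec; yes; no; ¬_; ¬?; contradiction; does)
open import Relation.Nullary.Decidable
  using (map′; _×-dec_; _⊎-dec_; _→-dec_; decidable-stable; dec-true; dec-false)
open import Relation.Unary using (Decidable; _∪_; _⊆_; U)

open Injection using (to; injective)

-- Least witnesses and exhaustive search over finite types.

least : ∀ {P : ℕ → Set} → Decidable P → ∃ P → ∃ (IsLeast P)
least {P} P? (k , Pk) = <-rec (λ k → P k → ∃ (IsLeast P)) step k Pk
  where
  step : ∀ k → (∀ {j} → j < k → P j → ∃ (IsLeast P)) → P k → ∃ (IsLeast P)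
  -- A bounded search below the witness either yields a smaller one to descend to or certifies
  -- minimality.
  step k rec Pk with anyUpTo? P? k
  ... | yes (j , j<k , Pj) = rec j<k Pj
  ... | no ∄j = k , Pk , λ j Pj → ≮⇒≥ λ j<k → ∄j (j , j<k , Pj)

Searchable : Set → Set₁
Searchable A = ∀ {P : A → Set} → Decidable P → Dec (∃ P)

searchable⇒all? : ∀ {A} → Searchable A → {P : A → Set} → Decidable P → Dec (∀ x → P x)
searchable⇒all? search P? = map′
  (λ ∄¬P x → decidable-stable (P? x) λ ¬Px → ∄¬P (x , ¬Px))
  (λ ∀P (x , ¬Px) → ¬Px (∀P x))
  (¬? (search (¬? ∘ P?)))

anyBool? : Searchable Bool
anyBool? P? = map′ [ true ,_ , false ,_ ]′
  (λ { (true , p) → inj₁ p ; (false , p) → inj₂ p })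
  (P? true ⊎-dec P? false)

-- Without function extensionality, only predicates that respect ≗ can be searched.
anyFunction? : ∀ {A} → Searchable A → ∀ m {P : (Fin m → A) → Set} →
               P Respects _≗_ → Decidable P → Dec (∃ P)
anyFunction? search zero resp P? =
  map′ (_ ,_) (λ (f , p) → resp (λ ()) p) (P? λ ())
anyFunction? search (suc m) resp P? = map′
  (λ (a , f , p) → a ∷ᶠ f , p)
  (λ (f , p) → head f , tail f , resp (λ { zero → refl ; (suc _) → refl }) p)
  (search λ a → anyFunction? search m
    (λ f≗g → resp λ { zero → refl ; (suc i) → f≗g i })
    (λ f → P? (a ∷ᶠ f)))

-- The search runs over the underlying functions, with injectivity as a decidable side condition.
-- The invariance of `P` makes it independent of the injectivity proof that an injection carries.
anyInjection? : ∀ {m n} {P : Fin m ↣ Fin n → Set} →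
                (∀ {φ ψ} → to φ ≗ to ψ → P φ → P ψ) → Decidable P → Dec (∃ P)
anyInjection? {m} {n} {P} resp P? = map′
  (λ (f , inj , p) → mk↣ (inj _ _) , p)
  (λ (φ , p) → to φ , (λ _ _ → injective φ) , resp (λ _ → refl) p)
  (anyFunction? Fin.any? m resp′ P′?)
  where
  P′ : (Fin m → Fin n) → Set
  P′ f = Σ[ inj ∈ (∀ x y → f x ≡ f y → x ≡ y) ] P (mk↣ (inj _ _))

  resp′ : P′ Respects _≗_
  resp′ f≗g (inj , p) =
    (λ x y gx≡gy → inj x y (trans (f≗g x) (trans gx≡gy (sym (f≗g y))))) , resp f≗g p

  P′? : Decidable P′
  P′? f with Fin.all? (λ x → Fin.all? (λ y → (f x Fin.≟ f y) →-dec (x Fin.≟ y)))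
  ... | no ¬inj = no (¬inj ∘ proj₁)
  ... | yes inj = map′ (inj ,_) (λ (_ , p) → resp (λ _ → refl) p) (P? (mk↣ (inj _ _)))

-- Counting, and sets of prescribed size between two given ones.

count : ∀ {A : Set} → (A → Bool) → List A → ℕ
count S xs = length (filterᵇ S xs)

module _ {A : Set} (_≟_ : DecidableEquality A) where

  _∖_ : (A → Bool) → A → A → Bool
  (S ∖ x) y = S y ∧ not (does (x ≟ y))

  count-∖ : ∀ (S : A → Bool) {x xs} → All (x ≢_) xs → count (S ∖ x) xs ≡ count S xs
  count-∖ S [] = refl
  count-∖ S {x} {y ∷ xs} (x≢y ∷ x∉xs) rewrite dec-false (x ≟ y) x≢y with S y
  ... | true  = cong suc (count-∖ S x∉xs)
  ... | false = count-∖ S x∉xs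

  ⊆-∖ : ∀ (P Q : A → Bool) {x} → ¬ T (P x) → (∀ y → T (P y) → T (Q y)) →
        ∀ y → T (P y) → T ((Q ∖ x) y)
  ⊆-∖ P Q {x} x∉P P⊆Q y Py with x ≟ y
  ... | yes refl = contradiction Py x∉P
  ... | no _ = Equivalence.from T-∧ (P⊆Q y Py , tt)

  -- Induction on the list. An element of `P` must be taken and one outside `Q` left out. One in `Q`
  -- but not in `P` is left out as long as `Q` still has `t` elements in the tail; otherwise `Q`
  -- itself has exactly `t`.
  interpolate : ∀ {xs : List A} → Unique xs → ∀ P Q t → (∀ x → T (P x) → T (Q x)) →
                count P xs ≤ t → t ≤ count Q xs →
                ∃[ S ] (∀ x → T (P x) → T (S x)) × (∀ x → T (S x) → T (Q x)) × count S xs ≡ t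
  interpolate [] P Q t P⊆Q p≤t z≤n = Q , P⊆Q , (λ _ → id) , refl
  interpolate {x ∷ xs} (x∉xs ∷ uniq) P Q t P⊆Q p≤t t≤q
    with P x in Px | Q x in Qx
  ... | true | false = contradiction (P⊆Q x (subst T (sym Px) tt)) (subst T Qx)
  interpolate {x ∷ xs} (x∉xs ∷ uniq) P Q (suc t) P⊆Q (s≤s p≤t) (s≤s t≤q) | true | true
    with S , P⊆S , S⊆Q , |S|≡t ← interpolate uniq P Q t P⊆Q p≤t t≤q
    = S , P⊆S , S⊆Q , |S|≡1+t
    where
    |S|≡1+t : count S (x ∷ xs) ≡ suc t
    -- The recursive call counts over `xs` only, but its inclusions hold on all of `A`, so the value
    -- of `S` at `x` is forced.
    |S|≡1+t with S x | P⊆S x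
    ... | true  | _ = cong suc |S|≡t
    ... | false | h = contradiction (h (subst T (sym Px) tt)) id
  interpolate {x ∷ xs} (x∉xs ∷ uniq) P Q t P⊆Q p≤t t≤q | false | false
    with S , P⊆S , S⊆Q , |S|≡t ← interpolate uniq P Q t P⊆Q p≤t t≤q
    = S , P⊆S , S⊆Q , |S|≡t′
    where
    |S|≡t′ : count S (x ∷ xs) ≡ t
    |S|≡t′ with S x | S⊆Q x
    ... | true  | h = contradiction (h tt) (subst T Qx)
    ... | false | _ = |S|≡t
  interpolate {x ∷ xs} (x∉xs ∷ uniq) P Q t P⊆Q p≤t t≤q | false | true with t ≤? count Q xs
  ... | no t≰q = Q , P⊆Q , (λ _ → id) , |Q|≡t
    where
    |Q|≡t : count Q (x ∷ xs) ≡ t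
    |Q|≡t rewrite Qx = ≤-antisym (≰⇒> t≰q) t≤q
  -- Removing `x` from `Q` forces `S x` to be false; the count over `xs` is unchanged because `x`
  -- does not occur there.
  ... | yes t≤q′
    with S , P⊆S , S⊆Q∖x , |S|≡t ←
      interpolate uniq P (Q ∖ x) t (⊆-∖ P Q (subst T Px) P⊆Q) p≤t
        (subst (t ≤_) (sym (count-∖ Q x∉xs)) t≤q′)
    = S , P⊆S , (λ y → proj₁ ∘ Equivalence.to T-∧ ∘ S⊆Q∖x y) , |S|≡t′
    where
    |S|≡t′ : count S (x ∷ xs) ≡ t
    |S|≡t′ with S x | S⊆Q∖x x
    ... | false | _ = |S|≡t
    ... | true  | h rewrite dec-true (x ≟ x) refl =
      contradiction (proj₂ (Equivalence.to (T-∧ {Q x}) (h tt))) id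

-- Edges of K_n: equality, enumeration and number.

edge-≡ : ∀ {n} {e f : Edge n} → u e ≡ u f → v e ≡ v f → e ≡ f
edge-≡ {e = edge i j p} {edge _ _ q} refl refl = cong (edge i j) (<-irrelevant p q)

_≟ᴱ_ : ∀ {n} → DecidableEquality (Edge n)
e ≟ᴱ f = map′ (λ (p , q) → edge-≡ p q) (λ { refl → refl , refl })
  ((u e Fin.≟ u f) ×-dec (v e Fin.≟ v f))

∈-edges : ∀ {n} (e : Edge n) → e ∈ edges n
∈-edges {suc n} (edge zero (suc j) (s≤s z≤n)) = ∈-++⁺ˡ (∈-map⁺ _ (∈-allFin j))
∈-edges {suc n} (edge (suc i) (suc j) (s≤s i<j)) =
  ∈-++⁺ʳ (map _ (allFin n)) (∈-map⁺ sucEdge (∈-edges (edge i j i<j)))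

edges-unique : ∀ n → Unique (edges n)
edges-unique zero = []
edges-unique (suc n) = Unique.++⁺
  (Unique.map⁺ (Fin.suc-injective ∘ cong v) (Unique.allFin⁺ n))
  (Unique.map⁺ sucEdge-injective (edges-unique n))
  disjoint
  where
  sucEdge-injective : ∀ {e f : Edge n} → sucEdge e ≡ sucEdge f → e ≡ f
  sucEdge-injective eq =
    edge-≡ (Fin.suc-injective (cong u eq)) (Fin.suc-injective (cong v eq))

  disjoint : ∀ {e} → ¬ (e ∈ map _ (allFin n) × e ∈ map sucEdge (edges n))
  disjoint (p , q) with ∈-map⁻ _ p | ∈-map⁻ sucEdge q
  ... | _ , _ , refl | _ , _ , ()

-- Pascal's rule: the `n` edges at the new vertex `zero` account for `n C 1`, the shifted edges for
-- `n C 2`.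
length-edges : ∀ n → length (edges n) ≡ n C 2
length-edges zero = refl
length-edges (suc n) = begin
  length (edges (suc n))
    ≡⟨ length-++ (map _ (allFin n)) ⟩
  length (map _ (allFin n)) + length (map sucEdge (edges n))
    ≡⟨ cong₂ _+_ (trans (length-map _ (allFin n)) (length-tabulate id))
                 (length-map sucEdge (edges n)) ⟩
  n + length (edges n)
    ≡⟨ cong₂ _+_ (sym (nC1≡n n)) (length-edges n) ⟩
  n C 1 + n C 2
    ≡⟨ nCk+nC[k+1]≡[n+1]C[k+1] n 1 ⟩
  suc n C 2 ∎
  where open ≡-Reasoning

-- Deciding statements about edges and edge sets.

anyEdge? : ∀ {n} → Searchable (Edge n)
anyEdge? {n} P? = map′ (λ a → let e , _ , p = find a in e , p)
  (λ (e , p) → lose (∈-edges e) p) (any? P? (edges n))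

allEdges? : ∀ {n} {P : Edge n → Set} → Decidable P → Dec (∀ {e} → P e)
allEdges? P? = map′ (λ h {e} → h e) (λ h e → h) (searchable⇒all? anyEdge? P?)

-- An edge set is encoded by one bit per position of `edges n`; `decode` reads the bit at the
-- position of a given edge. This turns the search into one over functions on a `Fin`.
anyEdgeSet? : ∀ {n} {P : EdgeSet n → Set} → P Respects _≗_ → Decidable P → Dec (∃ P)
anyEdgeSet? {n} {P} resp P? = map′
  (λ (f , p) → decode f , p)
  (λ (S , p) → S ∘ lookup (edges n) , resp (λ e → cong S (lookup-index (∈-edges e))) p)
  (anyFunction? anyBool? (length (edges n))
    (λ f≗g → resp (f≗g ∘ index ∘ ∈-edges)) (P? ∘ decode))
  where
  decode : (Fin (length (edges n)) → Bool) → EdgeSet n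
  decode f = f ∘ index ∘ ∈-edges

-- `searchable⇒all?` does not apply, since `anyEdgeSet?` searches only for predicates that respect
-- `≗`; the negation inherits this property by symmetry.
allEdgeSets? : ∀ {n} {P : EdgeSet n → Set} → P Respects _≗_ → Decidable P → Dec (∀ S → P S)
allEdgeSets? resp P? = map′
  (λ ∄¬P S → decidable-stable (P? S) λ ¬PS → ∄¬P (S , ¬PS))
  (λ ∀P (S , ¬PS) → ¬PS (∀P S))
  (¬? (anyEdgeSet? (λ S≗S′ ¬PS PS′ → ¬PS (resp (sym ∘ S≗S′) PS′)) (¬? ∘ P?)))

-- Complements and 2-colorings.

∁ : ∀ {n} → EdgeSet n → EdgeSet n
∁ S = not ∘ S

T-resp : ∀ {x y} → x ≡ y → T x → T y
T-resp = subst T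

¬T⇒T-not : ∀ {x} → ¬ T x → T (not x)
¬T⇒T-not {true}  ¬t = ¬t tt
¬T⇒T-not {false} _  = tt

T-not⇒¬T : ∀ {x} → T (not x) → ¬ T x
T-not⇒¬T {true} ()

card-cong : ∀ {n} {S S′ : EdgeSet n} → S ≗ S′ → ∣ S ∣ ≡ ∣ S′ ∣
card-cong {n} {S} {S′} S≗S′ = cong length
  (filter-≐ (T? ∘ S) (T? ∘ S′) ((λ {e} → T-resp (S≗S′ e)) , (λ {e} → T-resp (sym (S≗S′ e)))) (edges n))

card-∁ : ∀ {n} (S : EdgeSet n) → ∣ S ∣ + ∣ ∁ S ∣ ≡ n C 2
card-∁ {n} S = trans (go (edges n)) (length-edges n)
  where
  go : ∀ es → length (filterᵇ S es) + length (filterᵇ (∁ S) es) ≡ length es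
  go [] = refl
  go (e ∷ es) with S e
  ... | true  = cong suc (go es)
  ... | false = trans (+-suc _ _) (cong suc (go es))

partition-∁ : ∀ {n} (S : EdgeSet n) → U ≐ S ⊔ ∁ S
partition-∁ S = ((λ {e} _ → split e) , (λ _ → tt)) , λ {e} (p , q) → T-not⇒¬T {S e} q p
  where
  split : ∀ e → (⟦ S ⟧ ∪ ⟦ ∁ S ⟧) e
  split e with S e
  ... | true  = inj₁ tt
  ... | false = inj₂ tt

-- A 2-coloring is determined by its red class, so quantifying over 2-colorings reduces to
-- quantifying over one edge set.
partition⇒∁ : ∀ {n} {R B : EdgeSet n} → U ≐ R ⊔ B → B ≗ ∁ R
partition⇒∁ {R = R} {B} ((cover , _) , disj) e with R e | B e | cover {e} tt | disj {e}
... | true  | true  | _       | h = contradiction (tt , tt) h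
... | true  | false | _       | _ = refl
... | false | true  | _       | _ = refl
... | false | false | inj₁ () | _
... | false | false | inj₂ () | _

-- `unordered` consults the proof of distinctness only to refute equality, so different proofs give
-- the same edge.
unordered-cong : ∀ {n} {i i′ j j′ : Fin n} {p q} → i ≡ i′ → j ≡ j′ →
                 unordered i j p ≡ unordered i′ j′ q
unordered-cong {i = i} {j = j} {p = i≢j} refl refl with Fin.<-cmp i j
... | tri< _ _ _   = refl
... | tri≈ _ i≡j _ = contradiction i≡j i≢j
... | tri> _ _ _   = refl

-- No list is empty, which is the reason for R ∪ B = E(K_n).
∉b⇒∈r : ∀ c → T (not (b∈ c)) → T (r∈ c)
∉b⇒∈r ⟨r⟩ = id
∉b⇒∈r ⟨b⟩ ()
∉b⇒∈r ⟨r,b⟩ ()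

-- Balanced copies: monotonicity and decidability.

module _ {n : ℕ} (G : Graph) where

  -- The body of `BalancedCopy` with its three witnesses as parameters, so that they can be searched
  -- for one after another.
  BalancedAt : (R B : EdgeSet n) → Fin (order G) ↣ Fin n → (E₁ E₂ : EdgeSet n) → Set
  BalancedAt R B φ E₁ E₂ =
      (copyEdges {n} G φ ≐ E₁ ⊔ E₂)
    × (⟦ E₁ ⟧ ⊆ ⟦ R ⟧)
    × (⟦ E₂ ⟧ ⊆ ⟦ B ⟧)
    × (∣ ∣ E₁ ∣ - ∣ E₂ ∣ ∣ ≤ 1)

  balancedCopy-mono : ∀ {R R′ B B′ : EdgeSet n} → ⟦ R ⟧ ⊆ ⟦ R′ ⟧ → ⟦ B ⟧ ⊆ ⟦ B′ ⟧ →
                      BalancedCopy G R B → BalancedCopy G R′ B′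
  balancedCopy-mono R⊆R′ B⊆B′ (φ , E₁ , E₂ , copy , E₁⊆R , E₂⊆B , bal) =
    φ , E₁ , E₂ , copy , R⊆R′ ∘ E₁⊆R , B⊆B′ ∘ E₂⊆B , bal

  copyEdges-resp : ∀ {φ ψ} → to φ ≗ to ψ → copyEdges {n} G φ ⊆ copyEdges G ψ
  copyEdges-resp φ≗ψ (e@(edge i j _) , e∈G , refl) =
    e , e∈G , unordered-cong (sym (φ≗ψ i)) (sym (φ≗ψ j))

  balancedAt-resp : ∀ {R B φ ψ E₁ F₁ E₂ F₂} → to φ ≗ to ψ → E₁ ≗ F₁ → E₂ ≗ F₂ →
                    BalancedAt R B φ E₁ E₂ → BalancedAt R B ψ F₁ F₂
  balancedAt-resp {φ = φ} {ψ} φ≗ψ E₁≗F₁ E₂≗F₂ (((c⊆E , E⊆c) , disj) , E₁⊆R , E₂⊆B , bal) =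
    ( ( (λ {e} → [ inj₁ ∘ T-resp (E₁≗F₁ e) , inj₂ ∘ T-resp (E₂≗F₂ e) ]′
               ∘ c⊆E ∘ copyEdges-resp {ψ} {φ} (sym ∘ φ≗ψ))
      , (λ {e} → copyEdges-resp {φ} {ψ} φ≗ψ ∘ E⊆c
               ∘ [ inj₁ ∘ T-resp (sym (E₁≗F₁ e)) , inj₂ ∘ T-resp (sym (E₂≗F₂ e)) ]′))
    , (λ {e} (p , q) → disj (T-resp (sym (E₁≗F₁ e)) p , T-resp (sym (E₂≗F₂ e)) q)))
    , (λ {e} → E₁⊆R ∘ T-resp (sym (E₁≗F₁ e)))
    , (λ {e} → E₂⊆B ∘ T-resp (sym (E₂≗F₂ e)))
    , subst₂ (λ a b → ∣ a - b ∣ ≤ 1) (card-cong E₁≗F₁) (card-cong E₂≗F₂) bal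

  copyEdges? : ∀ φ → Decidable (copyEdges {n} G φ)
  copyEdges? φ e = anyEdge? λ e′ → T? (E G e′) ×-dec (mapEdge φ e′ ≟ᴱ e)

  ⟦_⟧? : (S : EdgeSet n) → Decidable ⟦ S ⟧
  ⟦ S ⟧? e = T? (S e)

  balancedAt? : ∀ R B φ E₁ E₂ → Dec (BalancedAt R B φ E₁ E₂)
  balancedAt? R B φ E₁ E₂ =
    ((allEdges? (λ e → copyEdges? φ e →-dec (⟦ E₁ ⟧? e ⊎-dec ⟦ E₂ ⟧? e))
        ×-dec allEdges? (λ e → (⟦ E₁ ⟧? e ⊎-dec ⟦ E₂ ⟧? e) →-dec copyEdges? φ e))
      ×-dec allEdges? (λ e → (⟦ E₁ ⟧? e ×-dec ⟦ E₂ ⟧? e) →-dec no id))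
    ×-dec allEdges? (λ e → ⟦ E₁ ⟧? e →-dec ⟦ R ⟧? e)
    ×-dec allEdges? (λ e → ⟦ E₂ ⟧? e →-dec ⟦ B ⟧? e)
    ×-dec (∣ ∣ E₁ ∣ - ∣ E₂ ∣ ∣ ≤? 1)

  balancedCopy? : ∀ R B → Dec (BalancedCopy {n} G R B)
  balancedCopy? R B =
    anyInjection?
      (λ {φ} {ψ} φ≗ψ (E₁ , E₂ , b) → E₁ , E₂ ,
        balancedAt-resp {φ = φ} {ψ} φ≗ψ (λ _ → refl) (λ _ → refl) b)
      λ φ → anyEdgeSet?
        (λ E₁≗F₁ (E₂ , b) → E₂ ,
          balancedAt-resp {φ = φ} {φ} (λ _ → refl) E₁≗F₁ (λ _ → refl) b)
        λ E₁ → anyEdgeSet?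
          (λ E₂≗F₂ → balancedAt-resp {φ = φ} {φ} (λ _ → refl) (λ _ → refl) E₂≗F₂)
          λ E₂ → balancedAt? R B φ E₁ E₂

  balCondition? : Decidable (BalCondition n G)
  balCondition? k = (2 * suc k ≤? n C 2) ×-dec
    map′ from∁ (λ h S → h S (∁ S) (partition-∁ S)) (allEdgeSets? resp P?)
    where
    P : EdgeSet n → Set
    P S = k < ∣ S ∣ → k < ∣ ∁ S ∣ → BalancedCopy G S (∁ S)

    P? : Decidable P
    P? S = (k <? ∣ S ∣) →-dec ((k <? ∣ ∁ S ∣) →-dec balancedCopy? S (∁ S))

    from∁ : (∀ S → P S) → ∀ R B → U ≐ R ⊔ B →
            k < ∣ R ∣ → k < ∣ B ∣ → BalancedCopy G R B
    from∁ h R B RB k<R k<B =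
      balancedCopy-mono id (λ {e} → T-resp (sym (B≗∁R e)))
        (h R k<R (subst (k <_) (card-cong B≗∁R) k<B))
      where
      B≗∁R : B ≗ ∁ R
      B≗∁R = partition⇒∁ RB

    resp : P Respects _≗_
    resp {S} {S′} S≗S′ h k<S′ k<∁S′ =
      balancedCopy-mono (λ {e} → T-resp (S≗S′ e)) (λ {e} → T-resp (cong not (S≗S′ e)))
        (h (subst (k <_) (card-cong (sym ∘ S≗S′)) k<S′)
           (subst (k <_) (card-cong (cong not ∘ sym ∘ S≗S′)) k<∁S′))

  -- Comparing the two conditions.

  bal⇒lbal : ∀ {k} → BalCondition n G k → LbalCondition n G k
  bal⇒lbal {k} (2k+2≤N , balanced) L k<R k<B with suc k ≤? ∣ ∁ (b∈ ∘ L) ∣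
  ... | yes k<∁B =
    -- The red class is the complement of B; the blue class is its double complement, which agrees
    -- with B pointwise.
    balancedCopy-mono (λ {e} → ∉b⇒∈r (L e)) (λ {e} → T-resp (not-involutive (b∈ (L e))))
      (balanced (∁ (b∈ ∘ L)) (∁ (∁ (b∈ ∘ L))) (partition-∁ _) k<∁B
        (subst (k <_) (card-cong (sym ∘ not-involutive ∘ b∈ ∘ L)) k<B))
  ... | no k≮∁B
    = let S , ∁B⊆S , S⊆R , |S|≡1+k =
            interpolate _≟ᴱ_ (edges-unique n) (∁ (b∈ ∘ L)) (r∈ ∘ L) (suc k) (∉b⇒∈r ∘ L)
              (≰⇒≥ k≮∁B) k<R
          k<∁S : k < ∣ ∁ S ∣
          -- Here the satisfiability bound 2(k+1) ≤ C(n,2) enters: `S` takes exactly k+1 edges and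
          -- leaves at least k+1 to its complement.
          k<∁S = +-cancelˡ-≤ (suc k) (suc k) ∣ ∁ S ∣ (begin
            suc k + suc k             ≡⟨ cong (suc k +_) (+-identityʳ (suc k)) ⟨
            2 * suc k                 ≤⟨ 2k+2≤N ⟩
            n C 2                     ≡⟨ card-∁ S ⟨
            ∣ S ∣ + ∣ ∁ S ∣ ≡⟨ cong (_+ ∣ ∁ S ∣) |S|≡1+k ⟩
            suc k + ∣ ∁ S ∣      ∎)
      in balancedCopy-mono (λ {e} → S⊆R e)
           -- Contraposing ∁B ⊆ S gives ∁S ⊆ B, up to a double negation removed by decidability.
           (λ {e} e∉S → decidable-stable (T? _) λ e∉B →
             T-not⇒¬T e∉S (∁B⊆S e (¬T⇒T-not e∉B)))
           (balanced S (∁ S) (partition-∁ S) (≤-reflexive (sym |S|≡1+k)) k<∁S)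
    where
    open ≤-Reasoning

  -- A 2-coloring is a list coloring with singleton lists. The bound on `k` is a separate hypothesis
  -- because `LbalCondition` does not contain it.
  lbal⇒bal : ∀ {k} → 2 * suc k ≤ n C 2 → LbalCondition n G k → BalCondition n G k
  lbal⇒bal {k} 2k+2≤N balanced = 2k+2≤N , λ R B RB k<R k<B →
    let L : Edge n → ListColor
        L e = if R e then ⟨r⟩ else ⟨b⟩

        r∈L≗R : r∈ ∘ L ≗ R
        r∈L≗R e = r∈-if (R e)

        b∈L≗B : b∈ ∘ L ≗ B
        b∈L≗B e = trans (b∈-if (R e)) (sym (partition⇒∁ RB e))
    in balancedCopy-mono (λ {e} → T-resp (r∈L≗R e)) (λ {e} → T-resp (b∈L≗B e))
         (balanced L (subst (k <_) (card-cong (sym ∘ r∈L≗R)) k<R)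
                     (subst (k <_) (card-cong (sym ∘ b∈L≗B)) k<B))
    where
    r∈-if : ∀ x → r∈ (if x then ⟨r⟩ else ⟨b⟩) ≡ x
    r∈-if true  = refl
    r∈-if false = refl

    b∈-if : ∀ x → b∈ (if x then ⟨r⟩ else ⟨b⟩) ≡ not x
    b∈-if true  = refl
    b∈-if false = refl

proposition4 : (G : Graph) (n : ℕ) → order G ≤ n → BalExists n G →
    ∃[ k ] (IsBal n G k × IsLbal n G k × 2 * k < n C 2)
proposition4 G n _ exists =
  -- The strict bound is 2k < 2(k+1) ≤ C(n,2).
  k , isBal , (bal⇒lbal G bal , lbal-least) , ≤-trans (*-monoʳ-< 2 (n<1+n k)) 2k+2≤N
  where
  least-bal : ∃ (IsBal n G)
  least-bal = least (balCondition? G) exists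

  k : ℕ
  k = proj₁ least-bal

  isBal : IsBal n G k
  isBal = proj₂ least-bal

  bal : BalCondition n G k
  bal = proj₁ isBal

  2k+2≤N : 2 * suc k ≤ n C 2
  2k+2≤N = proj₁ bal

  lbal-least : ∀ j → LbalCondition n G j → k ≤ j
  -- A smaller `j` inherits the size bound from `k`, so it would satisfy `BalCondition` and
  -- contradict the minimality of `k`.
  lbal-least j lbal = ≮⇒≥ λ j<k →
    let 2j+2≤N = ≤-trans (*-monoʳ-≤ 2 (s≤s (<⇒≤ j<k))) 2k+2≤N
    in <⇒≱ j<k (proj₂ isBal j (lbal⇒bal G 2j+2≤N lbal))
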